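{- Let $n$ be a positive integer and $\alpha\in[0,1]$, and let $G$ be a split graph that arises from the disjoint union of a clique $C$ of order $\alpha n$ and an independent set $I$ of order $(1-\alpha)n$ by adding $m$ edges between vertices in $C$ and vertices in $I$. Then $$Mo(G) \leq ((1+\alpha)n-1)m-\frac{2m^2}{(1-\alpha)n} \leq \begin{cases} \alpha(1-\alpha)n^2\big((1-\alpha)n-1\big) & \text{if } \alpha\leq \frac{1}{3}-\frac{1}{3n},\\[2mm] \frac{1}{8}(1-\alpha)n\big((1+\alpha)n-1\big)^2 & \text{if } \alpha>\frac{1}{3}-\frac{1}{3n}, \end{cases}$$ and moreover $Mo(G)\leq \frac{4}{27}n^3$.
   Context: All graphs are finite and simple. For a graph $G$ and an edge $uv$ of $G$, $n_G(u,v)$ denotes the number of vertices of $G$ whose distance in $G$ to $u$ is strictly smaller than their distance in $G$ to $v$. The Mostar index of $G$ is $Mo(G)=\sum_{uv\in E(G)}|n_G(u,v)-n_G(v,u)|$. Here $\alpha n$ and $(1-\alpha)n$ are the (integer) orders of $C$ and $I$. -}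

module Defs where

open import Data.Fin using (Fin; _<?_)
open import Data.Fin.Properties using (_≟_; any?)
open import Data.Fin.Subset using (Subset; _∈_; ∁)
open import Data.Fin.Subset.Properties using (_∈?_)
open import Data.Integer using (+_)
open import Data.List using (List; []; _∷_; length; filter; map; upTo; allFin; cartesianProduct)
open import Data.Nat as ℕ using (ℕ; zero; suc; ∣_-_∣)
open import Data.Nat.ListAction using (sum)
import Data.Nat.Properties as ℕ
open import Data.Product using (∃; _×_; _,_)
open import Data.Rational using (ℚ; 0ℚ; 1ℚ; _/_; _÷_; _+_; _*_; _-_; ≢-nonZero)
import Data.Rational.Properties as ℚ
open import Level using (0ℓ)
open import Relation.Binary using (Rel; Decidable; Symmetric)
open import Relation.Binary.Construct.Add.Supremum.Strict ℕ._<_ using (_<⁺_; <⁺-dec)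
open import Relation.Binary.PropositionalEquality using (_≡_; _≢_)
open import Relation.Nullary using (¬_; Dec; yes; no; _×-dec_)
open import Relation.Nullary.Construct.Add.Supremum using (_⁺; ⊤⁺; [_])

record Graph (n : ℕ) : Set₁ where
  field
    Adj    : Rel (Fin n) 0ℓ
    adj?   : Decidable Adj
    sym    : Symmetric Adj
    irrefl : ∀ v → ¬ Adj v v

first : List ℕ → ℕ ⁺
first []      = ⊤⁺
first (k ∷ _) = [ k ]

module _ {n : ℕ} (G : Graph n) where
  open Graph G

  Walk : ℕ → Rel (Fin n) 0ℓ
  Walk zero    u v = u ≡ v
  Walk (suc k) u v = ∃ λ w → Adj u w × Walk k w v

  walk? : ∀ k → Decidable (Walk k)
  walk? zero    u v = u ≟ v
  walk? (suc k) u v = any? (λ w → adj? u w ×-dec walk? k w v)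

  -- The least length of a walk from u to v, and ⊤⁺ (infinity) if there is
  -- none.  A shortest walk repeats no vertex, so only lengths below n matter.
  dist : Fin n → Fin n → ℕ ⁺
  dist u v = first (filter (λ k → walk? k u v) (upTo n))

  -- n_G(u,v).  A vertex in another component than u and v is at distance ⊤⁺
  -- from both and is not counted.
  closer : Fin n → Fin n → ℕ
  closer u v = length (filter (λ w → <⁺-dec ℕ._<?_ (dist w u) (dist w v)) (allFin n))

  -- Each edge is listed once, with its smaller endpoint first.
  edges : List (Fin n × Fin n)
  edges = filter (λ (u , v) → (u <? v) ×-dec adj? u v) (cartesianProduct (allFin n) (allFin n))

  Mo : ℕ
  Mo = sum (map (λ (u , v) → ∣ closer u v - closer v u ∣) edges)

  -- The independent set is the complement of C.
  record IsSplit (C : Subset n) : Set where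
    field
      clique      : ∀ {u v} → u ∈ C → v ∈ C → u ≢ v → Adj u v
      independent : ∀ {u v} → u ∈ ∁ C → v ∈ ∁ C → ¬ Adj u v

  crossEdges : Subset n → List (Fin n × Fin n)
  crossEdges C = filter (λ (u , v) → (u ∈? C) ×-dec (v ∈? ∁ C) ×-dec adj? u v) (cartesianProduct (allFin n) (allFin n))

fromℕ : ℕ → ℚ
fromℕ k = + k / 1

-- Total division, with p ÷₀ 0ℚ = 0ℚ.
infixl 7 _÷₀_
_÷₀_ : ℚ → ℚ → ℚ
p ÷₀ q with q ℚ.≟ 0ℚ
... | yes _  = 0ℚ
... | no q≢0 = _÷_ p q {{≢-nonZero q≢0}}

threshold : (n : ℕ) → .{{ℕ.NonZero n}} → ℚ
threshold n = + 1 / 3 - _/_ (+ 1) (3 ℕ.* n) {{ℕ.m*n≢0 3 n}}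

-- For α = 1 the independent set is empty and m = 0; the fraction, which would
-- be 0/0, is then read as 0.
edgeBound : (n : ℕ) (α : ℚ) (m : ℕ) → ℚ
edgeBound n α m = ((1ℚ + α) * fromℕ n - 1ℚ) * fromℕ m - (fromℕ 2 * (fromℕ m * fromℕ m)) ÷₀ ((1ℚ - α) * fromℕ n)

{-# OPTIONS --safe #-}
module Submission where

open import Defs

-- Let d(w) be the number of neighbours in C of w ∈ I, and |C| = c, |I| = i.
-- The endpoints of an edge always count themselves, so an edge contributes at
-- most the number of further vertices that are closer to one endpoint.  For an
-- edge uv inside C these are the w ∈ I adjacent to exactly one of u and v;
-- summing over u and v gives at most Σ d(w)(c - d(w)).  For an edge uw with
-- w ∈ I only w is closer to w, and the neighbours of w other than u are not
-- closer to u; summing gives at most Σ d(w)(n - 1 - d(w)).  As Σ d(w) = m, the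
-- first bound is Cauchy-Schwarz for d.  The others optimise a quadratic in
-- t = m / i on [0, c]: its vertex (n + c - 1)/4 is at least c exactly when
-- 3c ≤ n - 1.  The cubic bound is AM-GM applied to the vertex value.

module Counting where
  open import Data.Bool using (if_then_else_)
  open import Data.Fin using (Fin; zero; suc)
  import Data.Fin as Fin
  import Data.Fin.Properties as Fin
  open import Data.Fin.Subset using (Subset; inside; outside; _∈_; ∣_∣; ∁)
  open import Data.Fin.Subset.Properties using (_∈?_; x∉p⇒x∈∁p)
  open import Data.List using (List; []; _∷_; length; map; filter; allFin; applyUpTo; tabulate; cartesianProduct; _++_)
  open import Data.List.Properties using (map-tabulate; map-++; map-∘)
  open import Data.Nat using (ℕ; zero; suc; _+_; _*_; _≤_; _<_; z≤n; s≤s; ∣_-_∣)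
  import Data.Nat.ListAction as List
  open import Data.Nat.ListAction.Properties using (sum-++)
  open import Data.Nat.Properties as ℕ using (≤-refl; ≤-trans; module ≤-Reasoning)
  open import Algebra.Properties.Semiring.Sum ℕ.+-*-semiring
    using (sum; sum-cong-≗; ∑-distrib-+; ∑-comm; *-distribˡ-sum; *-distribʳ-sum; sum-replicate-zero)
  open import Data.Nat.Tactic.RingSolver using (solve-∀)
  open import Data.Product using (∃; _×_; _,_; proj₁)
  open import Data.Sum using (_⊎_; inj₁; inj₂)
  open import Data.Vec using ([]; _∷_)
  open import Function using (_∘_; id)
  open import Level using (0ℓ)
  open import Relation.Binary.Construct.Add.Supremum.Strict _<_ using (_<⁺_; [_]; [_]<⊤⁺; <⁺-dec)
  open import Relation.Binary.PropositionalEquality using (_≡_; _≢_; refl; sym; trans; cong; cong₂; subst; module ≡-Reasoning)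
  open import Relation.Nullary using (¬_; Dec; does; yes; no; _×-dec_; ¬?; contradiction)
  import Relation.Nullary.Construct.Add.Supremum as Sup
  open import Relation.Unary using (Pred; Decidable)

  private variable
    A B P Q : Set
    n : ℕ

  -- Indicators and finite sums

  𝟙 : Dec P → ℕ
  𝟙 d = if does d then 1 else 0

  𝟙-yes : (d : Dec P) → P → 𝟙 d ≡ 1
  𝟙-yes (yes _) _ = refl
  𝟙-yes (no ¬p) p = contradiction p ¬p

  𝟙-no : (d : Dec P) → ¬ P → 𝟙 d ≡ 0
  𝟙-no (yes p) ¬p = contradiction p ¬p
  𝟙-no (no _)  _  = refl

  𝟙-bound : (d : Dec P) {k : ℕ} → (P → 1 ≤ k) → 𝟙 d ≤ k
  𝟙-bound (yes p) f = f p
  𝟙-bound (no _)  f = z≤n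

  𝟙-exclusive : (d : Dec P) (e : Dec Q) → (P → ¬ Q) → 𝟙 d + 𝟙 e ≤ 1
  𝟙-exclusive (yes p) (yes q) P→¬Q = contradiction q (P→¬Q p)
  𝟙-exclusive (yes _) (no _)  _    = ≤-refl
  𝟙-exclusive (no _)  (yes _) _    = ≤-refl
  𝟙-exclusive (no _)  (no _)  _    = z≤n

  𝟙-∖ : (d : Dec P) (e : Dec Q) → (Q → P) → 𝟙 (d ×-dec ¬? e) + 𝟙 e ≡ 𝟙 d
  𝟙-∖ (yes _) (yes _) _   = refl
  𝟙-∖ (yes _) (no _)  _   = refl
  𝟙-∖ (no ¬p) (yes q) Q→P = contradiction (Q→P q) ¬p
  𝟙-∖ (no _)  (no _)  _   = refl

  -- Summed over all vertices, this splits them into `v` itself, its cross neighbours and the rest;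
  -- see `remote+degree`.
  𝟙-partition : (d : Dec P) (e : Dec Q) → (P → ¬ Q) → 𝟙 (¬? d ×-dec ¬? e) + 𝟙 e + 𝟙 d ≡ 1
  𝟙-partition (yes p) (yes q) P→¬Q = contradiction q (P→¬Q p)
  𝟙-partition (yes _) (no _)  _    = refl
  𝟙-partition (no _)  (yes _) _    = refl
  𝟙-partition (no _)  (no _)  _    = refl

  sum-mono-≤ : {f g : Fin n → ℕ} → (∀ i → f i ≤ g i) → sum f ≤ sum g
  sum-mono-≤ {zero}  f≤g = z≤n
  sum-mono-≤ {suc n} f≤g = ℕ.+-mono-≤ (f≤g zero) (sum-mono-≤ (f≤g ∘ suc))

  ≤-sum : (f : Fin n → ℕ) (i : Fin n) → f i ≤ sum f
  ≤-sum f zero    = ℕ.m≤m+n _ _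
  ≤-sum f (suc i) = ≤-trans (≤-sum (f ∘ suc) i) (ℕ.m≤n+m _ _)

  sum-𝟙-≟ : (u : Fin n) → sum (λ w → 𝟙 (w Fin.≟ u)) ≡ 1
  sum-𝟙-≟ {suc n} zero    = cong suc (sum-replicate-zero n)
  sum-𝟙-≟ {suc n} (suc u) = sum-𝟙-≟ u

  sum-1 : ∀ n → sum {n} (λ _ → 1) ≡ n
  sum-1 zero    = refl
  sum-1 (suc n) = cong suc (sum-1 n)

  ∣p∣≡sum : (p : Subset n) → ∣ p ∣ ≡ sum (λ u → 𝟙 (u ∈? p))
  ∣p∣≡sum []            = refl
  ∣p∣≡sum (inside  ∷ p) = cong suc (∣p∣≡sum p)
  ∣p∣≡sum (outside ∷ p) = ∣p∣≡sum p

  sum-tabulate : (f : Fin n → ℕ) → List.sum (tabulate f) ≡ sum f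
  sum-tabulate {zero}  f = refl
  sum-tabulate {suc n} f = cong (f zero +_) (sum-tabulate (f ∘ suc))

  sum-map-allFin : (f : Fin n → ℕ) → List.sum (map f (allFin n)) ≡ sum f
  sum-map-allFin f = trans (cong List.sum (map-tabulate id f)) (sum-tabulate f)

  sum-map-cartesianProduct : (f : A × B → ℕ) (xs : List A) (ys : List B) →
    List.sum (map f (cartesianProduct xs ys)) ≡ List.sum (map (λ x → List.sum (map (λ y → f (x , y)) ys)) xs)
  sum-map-cartesianProduct f []       ys = refl
  sum-map-cartesianProduct f (x ∷ xs) ys = begin
    List.sum (map f (map (x ,_) ys ++ cartesianProduct xs ys))
      ≡⟨ cong List.sum (map-++ f (map (x ,_) ys) _) ⟩
    List.sum (map f (map (x ,_) ys) ++ map f (cartesianProduct xs ys))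
      ≡⟨ sum-++ (map f (map (x ,_) ys)) _ ⟩
    List.sum (map f (map (x ,_) ys)) + List.sum (map f (cartesianProduct xs ys))
      ≡⟨ cong₂ _+_ (cong List.sum (sym (map-∘ ys))) (sum-map-cartesianProduct f xs ys) ⟩
    _ ∎
    where open ≡-Reasoning

  sum-map-allPairs : (f : Fin n × Fin n → ℕ) →
    List.sum (map f (cartesianProduct (allFin n) (allFin n))) ≡ sum (λ u → sum (λ v → f (u , v)))
  sum-map-allPairs f = trans (sum-map-cartesianProduct f (allFin _) (allFin _))
    (trans (sum-map-allFin (λ u → List.sum (map (λ v → f (u , v)) (allFin _)))) (sum-cong-≗ λ u → sum-map-allFin (λ v → f (u , v))))

  length-filter-𝟙 : {P : Pred A 0ℓ} (P? : Decidable P) (xs : List A) → length (filter P? xs) ≡ List.sum (map (𝟙 ∘ P?) xs)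
  length-filter-𝟙 P? []       = refl
  length-filter-𝟙 P? (x ∷ xs) with P? x
  ... | yes _ = cong suc (length-filter-𝟙 P? xs)
  ... | no _  = length-filter-𝟙 P? xs

  sum-map-filter-≤ : {P : Pred A 0ℓ} (P? : Decidable P) {f g : A → ℕ} → (∀ {x} → P x → f x ≤ g x) →
    (xs : List A) → List.sum (map f (filter P? xs)) ≤ List.sum (map g xs)
  sum-map-filter-≤ P? f≤g []       = z≤n
  sum-map-filter-≤ P? f≤g (x ∷ xs) with P? x
  ... | yes p = ℕ.+-mono-≤ (f≤g p) (sum-map-filter-≤ P? f≤g xs)
  ... | no _  = ≤-trans (sum-map-filter-≤ P? f≤g xs) (ℕ.m≤n+m _ _)

  -- Renaming the pair in the second half gives `h u v` the weight [u < v] + [v < u], which is at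
  -- most 1. This passes from edges listed once to ordered pairs.
  sum-unorderedPairs-≤ : (h : Fin n → Fin n → ℕ) →
    sum (λ u → sum (λ v → 𝟙 (u Fin.<? v) * (h u v + h v u))) ≤ sum (λ u → sum (λ v → h u v))
  sum-unorderedPairs-≤ h = begin
    sum (λ u → sum (λ v → o u v * (h u v + h v u)))
      ≡⟨ sum-cong-≗ (λ u → trans (sum-cong-≗ λ v → ℕ.*-distribˡ-+ (o u v) _ _) (∑-distrib-+ (λ v → o u v * h u v) _)) ⟩
    sum (λ u → sum (λ v → o u v * h u v) + sum (λ v → o u v * h v u))
      ≡⟨ ∑-distrib-+ (λ u → sum (λ v → o u v * h u v)) _ ⟩
    sum (λ u → sum (λ v → o u v * h u v)) + sum (λ u → sum (λ v → o u v * h v u))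
      ≡⟨ cong (sum (λ u → sum (λ v → o u v * h u v)) +_) (∑-comm (λ u v → o u v * h v u)) ⟩
    sum (λ u → sum (λ v → o u v * h u v)) + sum (λ u → sum (λ v → o v u * h u v))
      ≡⟨ ∑-distrib-+ (λ u → sum (λ v → o u v * h u v)) _ ⟨
    sum (λ u → sum (λ v → o u v * h u v) + sum (λ v → o v u * h u v))
      ≡⟨ sum-cong-≗ (λ u → trans (sum-cong-≗ λ v → ℕ.*-distribʳ-+ (h u v) (o u v) (o v u)) (∑-distrib-+ (λ v → o u v * h u v) _)) ⟨
    sum (λ u → sum (λ v → (o u v + o v u) * h u v))
      ≤⟨ sum-mono-≤ (λ u → sum-mono-≤ λ v → ℕ.*-monoˡ-≤ (h u v) (𝟙-exclusive (u Fin.<? v) (v Fin.<? u) Fin.<-asym)) ⟩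
    sum (λ u → sum (λ v → 1 * h u v))
      ≡⟨ sum-cong-≗ (λ u → sum-cong-≗ λ v → ℕ.*-identityˡ (h u v)) ⟩
    sum (λ u → sum (λ v → h u v)) ∎
    where
    open ≤-Reasoning
    o : (u v : Fin _) → ℕ
    o u v = 𝟙 (u Fin.<? v)

  -- Cauchy-Schwarz over the natural numbers

  -- The two sides differ by k², where `k` is the gap between `m` and `n`; the case split on their
  -- order avoids subtraction.
  2mn≤m²+n² : ∀ m n → m * n + m * n ≤ m * m + n * n
  2mn≤m²+n² m n with ℕ.≤-total m n
  ... | inj₁ m≤n with k , refl ← ℕ.m≤n⇒∃[o]m+o≡n m≤n = subst (m * (m + k) + m * (m + k) ≤_) (eq m k) (ℕ.m≤m+n _ (k * k))
    where
    eq : ∀ m k → m * (m + k) + m * (m + k) + k * k ≡ m * m + (m + k) * (m + k)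
    eq = solve-∀
  ... | inj₂ n≤m with k , refl ← ℕ.m≤n⇒∃[o]m+o≡n n≤m = subst ((n + k) * n + (n + k) * n ≤_) (eq n k) (ℕ.m≤m+n _ (k * k))
    where
    eq : ∀ n k → (n + k) * n + (n + k) * n + k * k ≡ (n + k) * (n + k) + n * n
    eq = solve-∀

  sum-*-sum : (f g : Fin n → ℕ) → sum f * sum g ≡ sum (λ u → sum (λ v → f u * g v))
  sum-*-sum f g = trans (*-distribʳ-sum (sum g) f) (sum-cong-≗ λ u → *-distribˡ-sum (f u) g)

  -- With `e` the indicator of `p`, sum 2 d(u) d(v) ≤ e(u) d(v)² + d(u)² e(v) over all pairs and
  -- cancel the 2. Support in `p` is what gives the factor `∣ p ∣` instead of `n`.
  cauchy-schwarz-on : (p : Subset n) (d : Fin n → ℕ) → (∀ v → d v ≡ 𝟙 (v ∈? p) * d v) →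
    sum d * sum d ≤ ∣ p ∣ * sum (λ v → d v * d v)
  cauchy-schwarz-on p d supp = ℕ.*-cancelˡ-≤ 2 (begin
    2 * (sum d * sum d)
      ≡⟨ cong (sum d * sum d +_) (ℕ.+-identityʳ _) ⟩
    sum d * sum d + sum d * sum d
      ≡⟨ cong₂ _+_ (sum-*-sum d d) (sum-*-sum d d) ⟩
    sum (λ u → sum (λ v → d u * d v)) + sum (λ u → sum (λ v → d u * d v))
      ≡⟨ sum²-distrib-+ (λ u v → d u * d v) (λ u v → d u * d v) ⟨
    sum (λ u → sum (λ v → d u * d v + d u * d v))
      ≤⟨ sum-mono-≤ (λ u → sum-mono-≤ λ v → pointwise u v) ⟩
    sum (λ u → sum (λ v → e u * (d v * d v) + (d u * d u) * e v))
      ≡⟨ sum²-distrib-+ (λ u v → e u * (d v * d v)) (λ u v → (d u * d u) * e v) ⟩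
    sum (λ u → sum (λ v → e u * (d v * d v))) + sum (λ u → sum (λ v → (d u * d u) * e v))
      ≡⟨ cong₂ _+_ (sum-*-sum e (λ v → d v * d v)) (sum-*-sum (λ u → d u * d u) e) ⟨
    sum e * S + S * sum e
      ≡⟨ cong₂ _+_ (cong (_* S) (sym (∣p∣≡sum p))) (trans (ℕ.*-comm S (sum e)) (cong (_* S) (sym (∣p∣≡sum p)))) ⟩
    ∣ p ∣ * S + ∣ p ∣ * S
      ≡⟨ cong (∣ p ∣ * S +_) (ℕ.+-identityʳ _) ⟨
    2 * (∣ p ∣ * S) ∎)
    where
    open ≤-Reasoning
    e : Fin _ → ℕ
    e u = 𝟙 (u ∈? p)
    S : ℕ
    S = sum (λ v → d v * d v)
    sum²-distrib-+ : (f g : Fin _ → Fin _ → ℕ) → sum (λ u → sum (λ v → f u v + g u v)) ≡ sum (λ u → sum (f u)) + sum (λ u → sum (g u))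
    sum²-distrib-+ f g = trans (sum-cong-≗ λ u → ∑-distrib-+ (f u) (g u)) (∑-distrib-+ (λ u → sum (f u)) (λ u → sum (g u)))
    pointwise : ∀ u v → d u * d v + d u * d v ≤ e u * (d v * d v) + (d u * d u) * e v
    pointwise u v with u ∈? p | v ∈? p | supp u | supp v
    -- Outside `p` the support condition reads d = 0, so the left side vanishes.
    ... | no _  | _     | du≡0 | _ rewrite du≡0 = z≤n
    ... | yes _ | no _  | _ | dv≡0 rewrite dv≡0 | ℕ.*-zeroʳ (d u) = z≤n
    ... | yes _ | yes _ | _ | _ = begin
      d u * d v + d u * d v           ≤⟨ 2mn≤m²+n² (d u) (d v) ⟩
      d u * d u + d v * d v           ≡⟨ ℕ.+-comm (d u * d u) _ ⟩
      d v * d v + d u * d u           ≡⟨ cong₂ _+_ (ℕ.*-identityˡ (d v * d v)) (ℕ.*-identityʳ (d u * d u)) ⟨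
      1 * (d v * d v) + d u * d u * 1 ∎

  -- Distances

  -- Specifies the truncated search behind `dist`: the value ⊤⁺ only excludes lengths below `n`.
  data LeastBelow (n : ℕ) (P : Pred ℕ 0ℓ) : ℕ Sup.⁺ → Set where
    none  : (∀ j → j < n → ¬ P j) → LeastBelow n P Sup.⊤⁺
    found : ∀ {k} → k < n → P k → (∀ j → j < k → ¬ P j) → LeastBelow n P Sup.[ k ]

  -- Here `i` counts the lengths already rejected and `f` is the shift by `i`, so that the tail,
  -- listed by `f ∘ suc`, fits the induction. Distances are the case i = 0.
  first-applyUpTo : {P : Pred ℕ 0ℓ} (P? : Decidable P) (n i : ℕ) (f : ℕ → ℕ) → (∀ j → f j ≡ i + j) →
    (∀ j → j < i → ¬ P j) → LeastBelow (i + n) P (first (filter P? (applyUpTo f n)))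
  first-applyUpTo {P} P? zero    i f f≡ below = none λ j j<i+0 → below j (subst (j <_) (ℕ.+-identityʳ i) j<i+0)
  first-applyUpTo {P} P? (suc n) i f f≡ below with P? (f 0)
  ... | yes p = found (subst (_< i + suc n) (sym (f≡ 0)) (ℕ.+-monoʳ-< i (s≤s z≤n))) p
                  λ j j<f0 → below j (subst (j <_) (trans (f≡ 0) (ℕ.+-identityʳ i)) j<f0)
  ... | no ¬p = subst (λ k → LeastBelow k P (first (filter P? (applyUpTo (f ∘ suc) n)))) (sym (ℕ.+-suc i n))
                  (first-applyUpTo P? n (suc i) (f ∘ suc) (λ j → trans (f≡ (suc j)) (ℕ.+-suc i j)) below′)
    where
    below′ : ∀ j → j < suc i → ¬ P j
    below′ j j<1+i with ℕ.m<1+n⇒m<n∨m≡n j<1+i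
    ... | inj₁ j<i  = below j j<i
    ... | inj₂ refl = ¬p ∘ subst P (sym (trans (f≡ 0) (ℕ.+-identityʳ i)))

  -- The smaller value is some finite `k` below `n`, so even ⊤⁺ on the other side excludes every
  -- length up to `k`.
  least-< : ∀ {P Q : Pred ℕ 0ℓ} {d e} → LeastBelow n P d → LeastBelow n Q e → d <⁺ e →
    ∃ λ k → P k × (∀ j → j ≤ k → ¬ Q j)
  least-< (found k<n p _) (none ¬Q)      _       = _ , p , λ j j≤k → ¬Q j (ℕ.≤-<-trans j≤k k<n)
  least-< (found _   p _) (found _ _ ¬Q) [ k<l ] = _ , p , λ j j≤k → ¬Q j (ℕ.≤-<-trans j≤k k<l)

  least-0-< : ∀ {P Q : Pred ℕ 0ℓ} {d e} → LeastBelow n P d → LeastBelow n Q e → 0 < n → P 0 → ¬ Q 0 → d <⁺ e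
  least-0-< (none ¬P)                _                         0<n P0 _   = contradiction P0 (¬P 0 0<n)
  least-0-< (found {suc k} _ _ ¬P)   _                         _   P0 _   = contradiction P0 (¬P 0 (s≤s z≤n))
  least-0-< (found {zero} _ _ _)     (none _)                  _   _  _   = [ 0 ]<⊤⁺
  least-0-< (found {zero} _ _ _)     (found {zero} _ Q0 _)     _   _  ¬Q0 = contradiction Q0 ¬Q0
  least-0-< (found {zero} _ _ _)     (found {suc l} _ _ _)     _   _  _   = [ s≤s z≤n ]

  module _ (G : Graph n) where
    -- Restates closeness by walks alone. The case analysis below only refutes walks from `w` to `v`
    -- of length 0, 1 and 2.
    CloserByWalk : Fin n → Fin n → Fin n → Set
    CloserByWalk w u v = ∃ λ k → Walk G k w u × (∀ j → j ≤ k → ¬ Walk G j w v)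

    dist-least : ∀ u v → LeastBelow n (λ k → Walk G k u v) (dist G u v)
    dist-least u v = first-applyUpTo (λ k → walk? G k u v) n 0 id (λ _ → refl) (λ _ ())

    dist<⇒CloserByWalk : ∀ {w u v} → dist G w u <⁺ dist G w v → CloserByWalk w u v
    dist<⇒CloserByWalk {w} {u} {v} = least-< (dist-least w u) (dist-least w v)

    dist-self-< : ∀ u v → u ≢ v → dist G u u <⁺ dist G u v
    dist-self-< u v = least-0-< (dist-least u u) (dist-least u v) (ℕ.≤-<-trans z≤n (Fin.toℕ<n u)) refl

    closer? : ∀ u v w → Dec (dist G w u <⁺ dist G w v)
    closer? u v w = <⁺-dec ℕ._<?_ (dist G w u) (dist G w v)

    closer≡sum : ∀ u v → closer G u v ≡ sum (λ w → 𝟙 (closer? u v w))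
    closer≡sum u v = trans (length-filter-𝟙 (closer? u v) (allFin n)) (sum-map-allFin (𝟙 ∘ closer? u v))

    -- The vertex `u` counts itself, being at distance 0 from itself and not from `v`.
    closer-positive : ∀ {u v} → u ≢ v → 1 ≤ closer G u v
    closer-positive {u} {v} u≢v = begin
      1                          ≡⟨ 𝟙-yes (closer? u v u) (dist-self-< u v u≢v) ⟨
      𝟙 (closer? u v u)          ≤⟨ ≤-sum (𝟙 ∘ closer? u v) u ⟩
      sum (𝟙 ∘ closer? u v)      ≡⟨ closer≡sum u v ⟨
      closer G u v               ∎
      where open ≤-Reasoning

  -- The two ends of an edge each count themselves, and these two units cancel in the difference;
  -- what remains is at most a maximum, hence at most a sum.
  ∣m-n∣≤predecessors : ∀ {m n p q} → 1 ≤ m → 1 ≤ n → m ≤ suc p → n ≤ suc q → ∣ m - n ∣ ≤ p + q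
  ∣m-n∣≤predecessors {suc m} {suc n} _ _ (s≤s m≤p) (s≤s n≤q) =
    ≤-trans (ℕ.∣m-n∣≤m⊔n m n) (≤-trans (ℕ.m⊔n≤m+n m n) (ℕ.+-mono-≤ m≤p n≤q))

  -- Counting in split graphs

  module Split (G : Graph n) (C : Subset n) (split : IsSplit G C) where
    open Graph G hiding (sym)
    open Graph G using () renaming (sym to adj-sym)
    open IsSplit split

    Cross : Fin n → Fin n → Set
    Cross u w = u ∈ C × w ∈ ∁ C × Adj u w

    cross? : ∀ u w → Dec (Cross u w)
    cross? u w = (u ∈? C) ×-dec (w ∈? ∁ C) ×-dec adj? u w

    missed? : ∀ v w → Dec (v ∈ C × ¬ Cross v w)
    missed? v w = (v ∈? C) ×-dec ¬? (cross? v w)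

    far? : ∀ v w → Dec (w ≢ v × ¬ Cross w v)
    far? v w = ¬? (w Fin.≟ v) ×-dec ¬? (cross? w v)

    -- In the notation of the overview these are d(w), c - d(w) and n - 1 - d(w).
    degree misses remote : Fin n → ℕ
    degree w = sum (λ u → 𝟙 (cross? u w))
    misses w = sum (λ v → 𝟙 (missed? v w))
    remote v = sum (λ w → 𝟙 (far? v w))

    misses+degree : ∀ w → misses w + degree w ≡ ∣ C ∣
    misses+degree w = begin
      misses w + degree w                            ≡⟨ ∑-distrib-+ (λ v → 𝟙 (missed? v w)) _ ⟨
      sum (λ v → 𝟙 (missed? v w) + 𝟙 (cross? v w))   ≡⟨ sum-cong-≗ pointwise ⟩
      sum (λ v → 𝟙 (v ∈? C))                         ≡⟨ ∣p∣≡sum C ⟨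
      ∣ C ∣                                          ∎
      where
      open ≡-Reasoning
      pointwise : ∀ v → 𝟙 (missed? v w) + 𝟙 (cross? v w) ≡ 𝟙 (v ∈? C)
      pointwise v = 𝟙-∖ (v ∈? C) (cross? v w) proj₁

    remote+degree : ∀ v → remote v + degree v + 1 ≡ n
    remote+degree v = begin
      remote v + degree v + 1
        ≡⟨ cong₂ _+_ (∑-distrib-+ (λ w → 𝟙 (far? v w)) _) (sum-𝟙-≟ v) ⟨
      sum (λ w → 𝟙 (far? v w) + 𝟙 (cross? w v)) + sum (λ w → 𝟙 (w Fin.≟ v))
        ≡⟨ ∑-distrib-+ (λ w → 𝟙 (far? v w) + 𝟙 (cross? w v)) _ ⟨
      sum (λ w → 𝟙 (far? v w) + 𝟙 (cross? w v) + 𝟙 (w Fin.≟ v))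
        ≡⟨ sum-cong-≗ pointwise ⟩
      sum {n} (λ _ → 1)
        ≡⟨ sum-1 n ⟩
      n ∎
      where
      open ≡-Reasoning
      pointwise : ∀ w → 𝟙 (far? v w) + 𝟙 (cross? w v) + 𝟙 (w Fin.≟ v) ≡ 1
      -- The classes are disjoint because `v` is not adjacent to itself.
      pointwise w = 𝟙-partition (w Fin.≟ v) (cross? w v) λ { refl (_ , _ , v~v) → irrefl v v~v }

    -- The form required by `cauchy-schwarz-on`: only vertices of the independent set have cross
    -- neighbours in `C`.
    degree-supported : ∀ w → degree w ≡ 𝟙 (w ∈? ∁ C) * degree w
    degree-supported w with w ∈? ∁ C
    ... | yes _  = sym (ℕ.*-identityˡ _)
    ... | no w∉I = trans (sum-cong-≗ λ u → vanish u) (sum-replicate-zero n)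
      where
      vanish : ∀ u → 𝟙 (u ∈? C ×-dec no w∉I ×-dec adj? u w) ≡ 0
      vanish u = 𝟙-no (u ∈? C ×-dec no w∉I ×-dec adj? u w) λ (_ , w∈I , _) → w∉I w∈I

    crossEdges≡sum : length (crossEdges G C) ≡ sum degree
    crossEdges≡sum = begin
      length (crossEdges G C)
        ≡⟨ length-filter-𝟙 (λ (u , v) → cross? u v) (cartesianProduct (allFin n) (allFin n)) ⟩
      List.sum (map (λ (u , v) → 𝟙 (cross? u v)) (cartesianProduct (allFin n) (allFin n)))
        ≡⟨ sum-map-allPairs (λ (u , v) → 𝟙 (cross? u v)) ⟩
      sum (λ u → sum (λ v → 𝟙 (cross? u v)))
        ≡⟨ ∑-comm (λ u v → 𝟙 (cross? u v)) ⟩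
      sum degree ∎
      where open ≡-Reasoning

    -- Every vertex of the independent set has at most `∣ C ∣` neighbours. This later confines t = m
    -- / i to at most c.
    crossEdges-≤ : length (crossEdges G C) ≤ ∣ ∁ C ∣ * ∣ C ∣
    crossEdges-≤ = begin
      length (crossEdges G C)                     ≡⟨ crossEdges≡sum ⟩
      sum degree                                  ≤⟨ sum-mono-≤ pointwise ⟩
      sum (λ w → 𝟙 (w ∈? ∁ C) * ∣ C ∣)            ≡⟨ *-distribʳ-sum ∣ C ∣ (λ w → 𝟙 (w ∈? ∁ C)) ⟨
      sum (λ w → 𝟙 (w ∈? ∁ C)) * ∣ C ∣            ≡⟨ cong (_* ∣ C ∣) (∣p∣≡sum (∁ C)) ⟨
      ∣ ∁ C ∣ * ∣ C ∣                             ∎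
      where
      open ≤-Reasoning
      pointwise : ∀ w → degree w ≤ 𝟙 (w ∈? ∁ C) * ∣ C ∣
      pointwise w = begin
        degree w                    ≡⟨ degree-supported w ⟩
        𝟙 (w ∈? ∁ C) * degree w     ≤⟨ ℕ.*-monoʳ-≤ (𝟙 (w ∈? ∁ C)) (subst (degree w ≤_) (misses+degree w) (ℕ.m≤n+m _ _)) ⟩
        𝟙 (w ∈? ∁ C) * ∣ C ∣        ∎

    -- Vertices closer to one end of an edge

    -- Let `w` differ from `u`. If `v` is outside `C`, then `uv` is a cross edge, and `w` is neither
    -- `v` nor adjacent to it. If `v` is in `C`, then `w` is not adjacent to `v` and so lies in the
    -- independent set. The first step `x` of its walk is in `C`, hence adjacent to `v`, so `w`
    -- reaches `v` in two steps; being closer to `u` then forces `x` to be `u`.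
    closer-cases : ∀ {u v w} → Adj u v → CloserByWalk G w u v →
      w ≡ u ⊎ (Cross u w × (v ∈ C × ¬ Cross v w)) ⊎ (Cross u v × (w ≢ v × ¬ Cross w v))
    closer-cases _ (zero , w≡u , _) = inj₁ w≡u
    closer-cases {u} {v} {w} u~v (suc k , (x , w~x , walk) , ¬walk) with v ∈? C
    ... | no v∉C = inj₂ (inj₂ ((u∈C , v∈I , u~v) , (λ w≡v → ¬walk 0 z≤n w≡v) , λ (_ , _ , w~v) → w≁v w~v))
      where
      w≁v : ¬ Adj w v
      w≁v w~v = ¬walk 1 (s≤s z≤n) (v , w~v , refl)
      v∈I = x∉p⇒x∈∁p v∉C
      u∈C : u ∈ C
      u∈C with u ∈? C
      ... | yes p = p
      ... | no u∉C = contradiction u~v (independent (x∉p⇒x∈∁p u∉C) v∈I)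
    ... | yes v∈C = inj₂ (inj₁ (cross k walk ¬walk , v∈C , λ (_ , _ , v~w) → w≁v (adj-sym v~w)))
      where
      w≁v : ¬ Adj w v
      w≁v w~v = ¬walk 1 (s≤s z≤n) (v , w~v , refl)
      w∈I : w ∈ ∁ C
      w∈I = x∉p⇒x∈∁p λ w∈C → w≁v (clique w∈C v∈C (¬walk 0 z≤n))
      x∈C : x ∈ C
      x∈C with x ∈? C
      ... | yes p = p
      ... | no x∉C = contradiction w~x (independent w∈I (x∉p⇒x∈∁p x∉C))
      cross : ∀ k → Walk G k x u → (∀ j → j ≤ suc k → ¬ Walk G j w v) → Cross u w
      cross zero    refl _     = x∈C , w∈I , adj-sym w~x
      -- The walk from `w` to `u` would have length at least 2, while w, x, v is a walk of length 2.
      cross (suc k) _    ¬walk = contradiction (x , w~x , v , clique x∈C v∈C x≢v , refl) (¬walk 2 (s≤s (s≤s z≤n)))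
        where
        x≢v : x ≢ v
        x≢v refl = w≁v w~x

    -- Bounds the vertices other than `u` that are closer to `u`. The first term serves edges inside
    -- `C`, the second those with `v` in the independent set. Both vanish for `u` in the independent
    -- set.
    excess : Fin n → Fin n → ℕ
    excess u v = sum (λ w → 𝟙 (cross? u w) * 𝟙 (missed? v w)) + 𝟙 (cross? u v) * remote v

    closer≤1+excess : ∀ {u v} → Adj u v → closer G u v ≤ suc (excess u v)
    closer≤1+excess {u} {v} u~v = begin
      closer G u v
        ≡⟨ closer≡sum G u v ⟩
      sum (λ w → 𝟙 (closer? G u v w))
        ≤⟨ sum-mono-≤ (λ w → 𝟙-bound (closer? G u v w) (bound w ∘ closer-cases u~v ∘ dist<⇒CloserByWalk G)) ⟩
      sum (λ w → a w + (b w + c w))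
        -- The unit is `u` itself.
        ≡⟨ trans (∑-distrib-+ a _) (cong₂ _+_ (sum-𝟙-≟ u) (∑-distrib-+ b c)) ⟩
      suc (sum b + sum c)
        ≡⟨ cong (λ s → suc (sum b + s)) (*-distribˡ-sum (𝟙 (cross? u v)) (λ w → 𝟙 (far? v w))) ⟨
      suc (excess u v) ∎
      where
      open ≤-Reasoning
      a b c : Fin n → ℕ
      a w = 𝟙 (w Fin.≟ u)
      b w = 𝟙 (cross? u w) * 𝟙 (missed? v w)
      c w = 𝟙 (cross? u v) * 𝟙 (far? v w)
      bound : ∀ w → w ≡ u ⊎ (Cross u w × (v ∈ C × ¬ Cross v w)) ⊎ (Cross u v × (w ≢ v × ¬ Cross w v)) → 1 ≤ a w + (b w + c w)
      bound w (inj₁ w≡u) = begin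
        1                  ≡⟨ 𝟙-yes (w Fin.≟ u) w≡u ⟨
        a w                ≤⟨ ℕ.m≤m+n _ _ ⟩
        a w + (b w + c w)  ∎
      bound w (inj₂ (inj₁ (p , q))) = begin
        1                  ≡⟨ cong₂ _*_ (𝟙-yes (cross? u w) p) (𝟙-yes (missed? v w) q) ⟨
        b w                ≤⟨ ℕ.m≤m+n _ _ ⟩
        b w + c w          ≤⟨ ℕ.m≤n+m _ (a w) ⟩
        a w + (b w + c w)  ∎
      bound w (inj₂ (inj₂ (p , q))) = begin
        1                  ≡⟨ cong₂ _*_ (𝟙-yes (cross? u v) p) (𝟙-yes (far? v w) q) ⟨
        c w                ≤⟨ ℕ.m≤n+m _ _ ⟩
        b w + c w          ≤⟨ ℕ.m≤n+m _ (a w) ⟩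
        a w + (b w + c w)  ∎

    Mo≤sum-excess : Mo G ≤ sum (λ u → sum (λ v → excess u v))
    Mo≤sum-excess = begin
      Mo G
        ≤⟨ sum-map-filter-≤ (λ (u , v) → (u Fin.<? v) ×-dec adj? u v) bound (cartesianProduct (allFin n) (allFin n)) ⟩
      List.sum (map (λ (u , v) → 𝟙 (u Fin.<? v) * (excess u v + excess v u)) (cartesianProduct (allFin n) (allFin n)))
        ≡⟨ sum-map-allPairs (λ (u , v) → 𝟙 (u Fin.<? v) * (excess u v + excess v u)) ⟩
      sum (λ u → sum (λ v → 𝟙 (u Fin.<? v) * (excess u v + excess v u)))
        ≤⟨ sum-unorderedPairs-≤ excess ⟩
      sum (λ u → sum (λ v → excess u v)) ∎
      where
      open ≤-Reasoning
      bound : {e : Fin n × Fin n} → let (u , v) = e in u Fin.< v × Adj u v →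
        ∣ closer G u v - closer G v u ∣ ≤ 𝟙 (u Fin.<? v) * (excess u v + excess v u)
      bound {u , v} (u<v , u~v) = begin
        ∣ closer G u v - closer G v u ∣
          ≤⟨ ∣m-n∣≤predecessors (closer-positive G (Fin.<⇒≢ u<v)) (closer-positive G (Fin.<⇒≢ u<v ∘ sym)) (closer≤1+excess u~v) (closer≤1+excess (adj-sym u~v)) ⟩
        excess u v + excess v u
          ≡⟨ ℕ.*-identityˡ _ ⟨
        1 * (excess u v + excess v u)
          ≡⟨ cong (_* (excess u v + excess v u)) (𝟙-yes (u Fin.<? v) u<v) ⟨
        𝟙 (u Fin.<? v) * (excess u v + excess v u) ∎

    -- Sum over `w` last: the pairs consisting of a neighbour of `w` in `C` and a vertex of `C`
    -- missed by `w` number d(w)(c - d(w)).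
    sum-excess : sum (λ u → sum (λ v → excess u v)) ≡ sum (λ w → degree w * misses w + degree w * remote w)
    sum-excess = begin
      sum (λ u → sum (λ v → sum (λ w → x u w * y v w) + x u v * remote v))
        ≡⟨ sum-cong-≗ (λ u → ∑-distrib-+ (λ v → sum (λ w → x u w * y v w)) _) ⟩
      sum (λ u → sum (λ v → sum (λ w → x u w * y v w)) + sum (λ v → x u v * remote v))
        ≡⟨ ∑-distrib-+ (λ u → sum (λ v → sum (λ w → x u w * y v w))) _ ⟩
      sum (λ u → sum (λ v → sum (λ w → x u w * y v w))) + sum (λ u → sum (λ v → x u v * remote v))
        ≡⟨ cong₂ _+_ onClique onCross ⟩
      sum (λ w → degree w * misses w) + sum (λ w → degree w * remote w)
        ≡⟨ ∑-distrib-+ (λ w → degree w * misses w) _ ⟨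
      sum (λ w → degree w * misses w + degree w * remote w) ∎
      where
      open ≡-Reasoning
      x y : Fin n → Fin n → ℕ
      x u w = 𝟙 (cross? u w)
      y v w = 𝟙 (missed? v w)
      onClique : sum (λ u → sum (λ v → sum (λ w → x u w * y v w))) ≡ sum (λ w → degree w * misses w)
      onClique = begin
        sum (λ u → sum (λ v → sum (λ w → x u w * y v w)))
          ≡⟨ sum-cong-≗ (λ u → ∑-comm (λ v w → x u w * y v w)) ⟩
        sum (λ u → sum (λ w → sum (λ v → x u w * y v w)))
          ≡⟨ ∑-comm (λ u w → sum (λ v → x u w * y v w)) ⟩
        sum (λ w → sum (λ u → sum (λ v → x u w * y v w)))
          ≡⟨ sum-cong-≗ (λ w → sum-*-sum (λ u → x u w) (λ v → y v w)) ⟨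
        sum (λ w → degree w * misses w) ∎
      onCross : sum (λ u → sum (λ v → x u v * remote v)) ≡ sum (λ w → degree w * remote w)
      onCross = trans (∑-comm (λ u v → x u v * remote v)) (sum-cong-≗ λ v → sym (*-distribʳ-sum (remote v) (λ u → x u v)))

    sumOfSquares : ℕ
    sumOfSquares = sum (λ w → degree w * degree w)

    -- All negative terms stand on the left to stay in ℕ. The vertex `w` contributes d(c - d) + d(n
    -- - 1 - d) + 2d² + d = (n + c)d with d = d(w).
    Mo-bound : Mo G + 2 * sumOfSquares + length (crossEdges G C) ≤ (n + ∣ C ∣) * length (crossEdges G C)
    Mo-bound = begin
      Mo G + 2 * S + length (crossEdges G C)
        ≤⟨ ℕ.+-mono-≤ (ℕ.+-monoˡ-≤ (2 * S) (≤-trans Mo≤sum-excess (ℕ.≤-reflexive sum-excess))) (ℕ.≤-reflexive crossEdges≡sum) ⟩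
      sum (λ w → degree w * misses w + degree w * remote w) + 2 * S + sum degree
        ≡⟨ cong (λ s → sum (λ w → degree w * misses w + degree w * remote w) + s + sum degree) (*-distribˡ-sum 2 (λ w → degree w * degree w)) ⟩
      sum (λ w → degree w * misses w + degree w * remote w) + sum (λ w → 2 * (degree w * degree w)) + sum degree
        ≡⟨ cong (_+ sum degree) (∑-distrib-+ (λ w → degree w * misses w + degree w * remote w) _) ⟨
      sum (λ w → degree w * misses w + degree w * remote w + 2 * (degree w * degree w)) + sum degree
        ≡⟨ ∑-distrib-+ (λ w → degree w * misses w + degree w * remote w + 2 * (degree w * degree w)) degree ⟨
      sum (λ w → degree w * misses w + degree w * remote w + 2 * (degree w * degree w) + degree w)
        ≡⟨ sum-cong-≗ pointwise ⟩
      sum (λ w → (n + ∣ C ∣) * degree w)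
        ≡⟨ *-distribˡ-sum (n + ∣ C ∣) degree ⟨
      (n + ∣ C ∣) * sum degree
        ≡⟨ cong ((n + ∣ C ∣) *_) crossEdges≡sum ⟨
      (n + ∣ C ∣) * length (crossEdges G C) ∎
      where
      open ≤-Reasoning
      S = sumOfSquares
      expand : ∀ d y z → d * y + d * z + 2 * (d * d) + d ≡ (z + d + 1 + (y + d)) * d
      expand = solve-∀
      pointwise : ∀ w → degree w * misses w + degree w * remote w + 2 * (degree w * degree w) + degree w ≡ (n + ∣ C ∣) * degree w
      pointwise w = trans (expand (degree w) (misses w) (remote w))
        (cong₂ (λ a b → (a + b) * degree w) (remote+degree w) (misses+degree w))

    crossEdges²-≤ : length (crossEdges G C) * length (crossEdges G C) ≤ ∣ ∁ C ∣ * sumOfSquares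
    crossEdges²-≤ = subst (λ m → m * m ≤ ∣ ∁ C ∣ * sumOfSquares) (sym crossEdges≡sum) (cauchy-schwarz-on (∁ C) degree degree-supported)

open import Data.Fin.Subset using (Subset; ∣_∣; ∁)
open import Data.List using (length)
open import Data.Integer as ℤ using (+_)
import Data.Integer.Properties as ℤ
open import Data.Nat as ℕ using (ℕ; suc; NonZero)
import Data.Nat.Properties as ℕ
open import Data.Product using (∃; _×_; _,_)
open import Data.Rational using (ℚ; 0ℚ; 1ℚ; _/_; _÷_; 1/_; _+_; _*_; _-_; -_; _≤_; _<_; toℚᵘ; nonNegative; nonPositive; ≢-nonZero)
open import Data.Rational.Properties as ℚ using (≤-trans; toℚᵘ-injective; toℚᵘ-fromℚᵘ; toℚᵘ-homo-+; toℚᵘ-homo-*; toℚᵘ-cancel-≤)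
open import Data.Rational.Solver using (module +-*-Solver)
open +-*-Solver using (solve; _:+_; _:*_; _:-_; _:=_; con)
open import Data.Rational.Unnormalised as ℚᵘ using (mkℚᵘ; *≡*; *≤*)
import Data.Rational.Unnormalised.Properties as ℚᵘ
open import Data.Sum using (inj₁; inj₂)
open import Relation.Binary.PropositionalEquality using (_≡_; _≢_; refl; sym; trans; cong; cong₂; subst; subst₂; module ≡-Reasoning)
open import Relation.Nullary using (yes; no; contradiction)

-- The embedding of the natural numbers in ℚ

toℚᵘ-fromℕ : ∀ k → toℚᵘ (fromℕ k) ℚᵘ.≃ mkℚᵘ (+ k) 0
toℚᵘ-fromℕ k = toℚᵘ-fromℚᵘ (mkℚᵘ (+ k) 0)

fromℕ-+ : ∀ a b → fromℕ (a ℕ.+ b) ≡ fromℕ a + fromℕ b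
fromℕ-+ a b = toℚᵘ-injective (begin
  toℚᵘ (fromℕ (a ℕ.+ b))              ≈⟨ toℚᵘ-fromℕ (a ℕ.+ b) ⟩
  mkℚᵘ (+ (a ℕ.+ b)) 0                ≈⟨ *≡* (cong (ℤ._* + 1) (sym (cong₂ ℤ._+_ (ℤ.*-identityʳ (+ a)) (ℤ.*-identityʳ (+ b))))) ⟩
  mkℚᵘ (+ a) 0 ℚᵘ.+ mkℚᵘ (+ b) 0      ≈⟨ ℚᵘ.+-cong (toℚᵘ-fromℕ a) (toℚᵘ-fromℕ b) ⟨
  toℚᵘ (fromℕ a) ℚᵘ.+ toℚᵘ (fromℕ b)  ≈⟨ toℚᵘ-homo-+ (fromℕ a) (fromℕ b) ⟨
  toℚᵘ (fromℕ a + fromℕ b)            ∎)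
  where open import Relation.Binary.Reasoning.Setoid ℚᵘ.≃-setoid

fromℕ-* : ∀ a b → fromℕ (a ℕ.* b) ≡ fromℕ a * fromℕ b
fromℕ-* a b = toℚᵘ-injective (begin
  toℚᵘ (fromℕ (a ℕ.* b))              ≈⟨ toℚᵘ-fromℕ (a ℕ.* b) ⟩
  mkℚᵘ (+ (a ℕ.* b)) 0                ≈⟨ *≡* (cong (ℤ._* + 1) (ℤ.pos-* a b)) ⟩
  mkℚᵘ (+ a) 0 ℚᵘ.* mkℚᵘ (+ b) 0      ≈⟨ ℚᵘ.*-cong (toℚᵘ-fromℕ a) (toℚᵘ-fromℕ b) ⟨
  toℚᵘ (fromℕ a) ℚᵘ.* toℚᵘ (fromℕ b)  ≈⟨ toℚᵘ-homo-* (fromℕ a) (fromℕ b) ⟨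
  toℚᵘ (fromℕ a * fromℕ b)            ∎)
  where open import Relation.Binary.Reasoning.Setoid ℚᵘ.≃-setoid

fromℕ-mono-≤ : ∀ {a b} → a ℕ.≤ b → fromℕ a ≤ fromℕ b
fromℕ-mono-≤ {a} {b} a≤b = toℚᵘ-cancel-≤ (begin
  toℚᵘ (fromℕ a)  ≃⟨ toℚᵘ-fromℕ a ⟩
  mkℚᵘ (+ a) 0    ≤⟨ *≤* (ℤ.*-monoʳ-≤-nonNeg (+ 1) (ℤ.+≤+ a≤b)) ⟩
  mkℚᵘ (+ b) 0    ≃⟨ toℚᵘ-fromℕ b ⟨
  toℚᵘ (fromℕ b)  ∎)
  where open ℚᵘ.≤-Reasoning

fromℕ-nonneg : ∀ k → 0ℚ ≤ fromℕ k
fromℕ-nonneg k = fromℕ-mono-≤ {0} {k} ℕ.z≤n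

1/k*k : ∀ k .{{_ : NonZero k}} → (+ 1 / k) * fromℕ k ≡ 1ℚ
1/k*k (suc k) = toℚᵘ-injective (begin
  toℚᵘ ((+ 1 / suc k) * fromℕ (suc k))              ≈⟨ toℚᵘ-homo-* (+ 1 / suc k) (fromℕ (suc k)) ⟩
  toℚᵘ (+ 1 / suc k) ℚᵘ.* toℚᵘ (fromℕ (suc k))      ≈⟨ ℚᵘ.*-cong (toℚᵘ-fromℚᵘ (mkℚᵘ (+ 1) k)) (toℚᵘ-fromℕ (suc k)) ⟩
  mkℚᵘ (+ 1) k ℚᵘ.* mkℚᵘ (+ suc k) 0                ≈⟨ *≡* (trans (ℤ.*-identityʳ _) (cong (λ j → + 1 ℤ.* + suc j) (sym (ℕ.*-identityʳ k)))) ⟩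
  toℚᵘ 1ℚ                                           ∎)
  where open import Relation.Binary.Reasoning.Setoid ℚᵘ.≃-setoid

-- Inequalities and division in ℚ

-- Reduces an inequality to a nonnegative certificate `r` and a ring identity; the optimisation
-- bounds are proved in this way.
≤-by-difference : ∀ {p q r} → 0ℚ ≤ r → p + r ≡ q → p ≤ q
≤-by-difference {p} {q} {r} 0≤r p+r≡q = subst₂ _≤_ (ℚ.+-identityʳ p) p+r≡q (ℚ.+-monoʳ-≤ p 0≤r)

0≤q-p : ∀ {p q} → p ≤ q → 0ℚ ≤ q - p
0≤q-p {p} {q} p≤q = subst (_≤ q - p) (ℚ.+-inverseʳ p) (ℚ.+-monoˡ-≤ (- p) p≤q)

+-nonneg : ∀ {p q} → 0ℚ ≤ p → 0ℚ ≤ q → 0ℚ ≤ p + q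
+-nonneg 0≤p 0≤q = ℚ.+-mono-≤ 0≤p 0≤q

*-nonneg : ∀ {p q} → 0ℚ ≤ p → 0ℚ ≤ q → 0ℚ ≤ p * q
*-nonneg {p} {q} 0≤p 0≤q = subst (_≤ p * q) (ℚ.*-zeroʳ p) (ℚ.*-monoˡ-≤-nonNeg p {{nonNegative 0≤p}} 0≤q)

square-nonneg : ∀ p → 0ℚ ≤ p * p
square-nonneg p with ℚ.≤-total 0ℚ p
... | inj₁ 0≤p = *-nonneg 0≤p 0≤p
... | inj₂ p≤0 = subst (_≤ p * p) (ℚ.*-zeroʳ p) (ℚ.*-monoˡ-≤-nonPos p {{nonPositive p≤0}} p≤0)

[q*p]÷q≡p : ∀ p q .{{_ : Data.Rational.NonZero q}} → (q * p) ÷ q ≡ p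
[q*p]÷q≡p p q = begin
  q * p * 1/ q      ≡⟨ cong (_* 1/ q) (ℚ.*-comm q p) ⟩
  p * q * 1/ q      ≡⟨ ℚ.*-assoc p q (1/ q) ⟩
  p * (q * 1/ q)    ≡⟨ cong (p *_) (ℚ.*-inverseʳ q) ⟩
  p * 1ℚ            ≡⟨ ℚ.*-identityʳ p ⟩
  p                 ∎
  where open ≡-Reasoning

-- The second factor q makes the junk value q = 0 harmless.
*-÷₀-cancel : ∀ p q → (q * (q * p)) ÷₀ q ≡ q * p
*-÷₀-cancel p q with q ℚ.≟ 0ℚ
... | yes refl = sym (ℚ.*-zeroˡ p)
... | no q≢0   = [q*p]÷q≡p (q * p) q {{≢-nonZero q≢0}}

q*[p÷q]≡p : ∀ p q .{{_ : Data.Rational.NonZero q}} → q * (p ÷ q) ≡ p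
q*[p÷q]≡p p q = trans (sym (ℚ.*-assoc q p (1/ q))) ([q*p]÷q≡p p q)

positive-from-≤-≢ : ∀ {q} → 0ℚ ≤ q → q ≢ 0ℚ → Data.Rational.Positive q
positive-from-≤-≢ {q} 0≤q q≢0 = ℚ.nonNeg∧nonZero⇒pos q {{nonNegative 0≤q}} {{≢-nonZero q≢0}}

-- At q = 0 the quotient is 0 by convention, and `0ℚ ≤ r` settles that case.
÷₀-≤ : ∀ {p q r} → 0ℚ ≤ q → 0ℚ ≤ r → p ≤ q * r → p ÷₀ q ≤ r
÷₀-≤ {p} {q} {r} 0≤q 0≤r p≤qr with q ℚ.≟ 0ℚ
... | yes _  = 0≤r
... | no q≢0 = ℚ.*-cancelˡ-≤-pos q {{positive-from-≤-≢ 0≤q q≢0}}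
                 (subst (_≤ q * r) (sym (q*[p÷q]≡p p q {{≢-nonZero q≢0}})) p≤qr)

-- Substituting m = i t makes the bounds polynomial. At i = 0 the hypotheses squeeze `m` to 0, so t
-- = 0 serves.
∃-ratio : ∀ {m i c} → 0ℚ ≤ i → 0ℚ ≤ c → 0ℚ ≤ m → m ≤ i * c → ∃ λ t → t ≤ c × i * t ≡ m
∃-ratio {m} {i} {c} 0≤i 0≤c 0≤m m≤ic with i ℚ.≟ 0ℚ
... | yes refl = 0ℚ , 0≤c , ℚ.≤-antisym 0≤m (subst (m ≤_) (ℚ.*-zeroˡ c) m≤ic)
... | no i≢0 = _÷_ m i {{≢-nonZero i≢0}} , ℚ.*-cancelˡ-≤-pos i {{positive-from-≤-≢ 0≤i i≢0}} (subst (_≤ i * c) (sym eq) m≤ic) , eq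
  where eq = q*[p÷q]≡p m i {{≢-nonZero i≢0}}

-- Multiplication by 3n clears both denominators, so that α ≤ `threshold n` turns into 3c ≤ n - 1.
threshold-scaled : ∀ n .{{_ : NonZero n}} → threshold n * (fromℕ 3 * fromℕ n) ≡ fromℕ n - 1ℚ
threshold-scaled n = begin
  (+ 1 / 3 - r) * (fromℕ 3 * fromℕ n)
    ≡⟨ solve 2 (λ r N → (con (+ 1 / 3) :- r) :* (con (fromℕ 3) :* N) := N :- r :* (con (fromℕ 3) :* N)) refl r (fromℕ n) ⟩
  fromℕ n - r * (fromℕ 3 * fromℕ n)
    ≡⟨ cong (λ s → fromℕ n - r * s) (fromℕ-* 3 n) ⟨
  fromℕ n - r * fromℕ (3 ℕ.* n)
    ≡⟨ cong (λ s → fromℕ n - s) (1/k*k (3 ℕ.* n) {{ℕ.m*n≢0 3 n}}) ⟩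
  fromℕ n - 1ℚ ∎
  where
  open ≡-Reasoning
  r = _/_ (+ 1) (3 ℕ.* n) {{ℕ.m*n≢0 3 n}}

-- Optimising the quadratic

2ℚ : ℚ
2ℚ = fromℕ 2

-- This is `edgeBound` with (1 + α)n - 1 and (1 - α)n replaced by variables.
quadratic : ℚ → ℚ → ℚ → ℚ
quadratic k i m = k * m - (2ℚ * (m * m)) ÷₀ i

quadratic-scaled : ∀ k i t → quadratic k i (i * t) ≡ k * (i * t) - i * (2ℚ * (t * t))
quadratic-scaled k i t = cong (λ s → k * (i * t) - s) (begin
  (2ℚ * (i * t * (i * t))) ÷₀ i
    ≡⟨ cong (_÷₀ i) (solve 2 (λ i t → con 2ℚ :* (i :* t :* (i :* t)) := i :* (i :* (con 2ℚ :* (t :* t)))) refl i t) ⟩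
  (i * (i * (2ℚ * (t * t)))) ÷₀ i
    ≡⟨ *-÷₀-cancel (2ℚ * (t * t)) i ⟩
  i * (2ℚ * (t * t)) ∎)
  where open ≡-Reasoning

module Bounds {c i : ℚ} (0≤c : 0ℚ ≤ c) (0≤i : 0ℚ ≤ i) where

  -- With n = c + i this is n + c - 1, that is (1 + α)n - 1.
  k : ℚ
  k = c + i + c - 1ℚ

  -- Here `s` stands for the sum of squared degrees: solve the first bound for `μ`, then use s ≥ m²
  -- / i from Cauchy-Schwarz.
  ≤-quadratic : ∀ {μ m s} → 0ℚ ≤ s → μ + 2ℚ * s + m ≤ (c + i + c) * m → m * m ≤ i * s → μ ≤ quadratic k i m
  ≤-quadratic {μ} {m} {s} 0≤s h m²≤is = begin
    μ
      ≡⟨ solve 3 (λ μ m s → μ := (μ :+ con 2ℚ :* s :+ m) :- (con 2ℚ :* s :+ m)) refl μ m s ⟩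
    (μ + 2ℚ * s + m) - (2ℚ * s + m)
      ≤⟨ ℚ.+-monoˡ-≤ (- (2ℚ * s + m)) h ⟩
    (c + i + c) * m - (2ℚ * s + m)
      ≡⟨ solve 4 (λ c i m s → (c :+ i :+ c) :* m :- (con 2ℚ :* s :+ m) := (c :+ i :+ c :- con 1ℚ) :* m :- con 2ℚ :* s) refl c i m s ⟩
    k * m - 2ℚ * s
      ≤⟨ ℚ.+-monoʳ-≤ (k * m) (ℚ.neg-antimono-≤ (÷₀-≤ 0≤i (*-nonneg (fromℕ-nonneg 2) 0≤s) 2m²≤2is)) ⟩
    quadratic k i m ∎
    where
    open ℚ.≤-Reasoning
    2m²≤2is : 2ℚ * (m * m) ≤ i * (2ℚ * s)
    2m²≤2is = subst (2ℚ * (m * m) ≤_) (solve 2 (λ i s → con 2ℚ :* (i :* s) := i :* (con 2ℚ :* s)) refl i s)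
      (ℚ.*-monoˡ-≤-nonNeg 2ℚ m²≤is)

  quadratic-≤-endpoint : ∀ {m} → 0ℚ ≤ m → m ≤ i * c → c * fromℕ 3 ≤ c + i - 1ℚ → quadratic k i m ≤ c * i * (i - 1ℚ)
  quadratic-≤-endpoint 0≤m m≤ic 3c≤n-1 with t , t≤c , refl ← ∃-ratio 0≤i 0≤c 0≤m m≤ic =
    ≤-by-difference
      -- The value at t = c exceeds that at `t` by i(c - t)(i - 1 - 2t); the last factor is written
      -- as (n - 1 - 3c) + 2(c - t) to show its sign.
      (*-nonneg 0≤i (*-nonneg (0≤q-p t≤c) (+-nonneg (0≤q-p 3c≤n-1) (*-nonneg (fromℕ-nonneg 2) (0≤q-p t≤c)))))
      (trans (cong (_+ i * ((c - t) * (c + i - 1ℚ - c * fromℕ 3 + 2ℚ * (c - t)))) (quadratic-scaled k i t))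
        (solve 3 (λ c i t → ((c :+ i :+ c :- con 1ℚ) :* (i :* t) :- i :* (con 2ℚ :* (t :* t)))
            :+ i :* ((c :- t) :* (c :+ i :- con 1ℚ :- c :* con (fromℕ 3) :+ con 2ℚ :* (c :- t)))
            := c :* i :* (i :- con 1ℚ)) refl c i t))

  quadratic-≤-vertex : ∀ {m} → 0ℚ ≤ m → m ≤ i * c → quadratic k i m ≤ (+ 1 / 8) * i * (k * k)
  quadratic-≤-vertex 0≤m m≤ic with t , _ , refl ← ∃-ratio 0≤i 0≤c 0≤m m≤ic =
    ≤-by-difference
      -- Completing the square at the vertex t = k / 4 leaves (i / 8)(k - 4t)².
      (*-nonneg (*-nonneg {+ 1 / 8} (ℚ.nonNegative⁻¹ (+ 1 / 8)) 0≤i) (square-nonneg (k - fromℕ 4 * t)))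
      (trans (cong (_+ (+ 1 / 8) * i * ((k - fromℕ 4 * t) * (k - fromℕ 4 * t))) (quadratic-scaled k i t))
        (solve 3 (λ k i t → (k :* (i :* t) :- i :* (con 2ℚ :* (t :* t)))
            :+ con (+ 1 / 8) :* i :* ((k :- con (fromℕ 4) :* t) :* (k :- con (fromℕ 4) :* t))
            := con (+ 1 / 8) :* i :* (k :* k)) refl k i t))

  -- AM-GM for i and l = 2n - i: 4(i + l)³ - 27 i l² = (l - 2i)² (4l + i).
  vertex-≤-cubic : 1ℚ ≤ c + i → (+ 1 / 8) * i * (k * k) ≤ (+ 4 / 27) * ((c + i) * (c + i) * (c + i))
  vertex-≤-cubic 1≤n =
    ≤-by-difference
      (+-nonneg
        -- Since c + i = (l + i) / 2, the identity divided by 216 compares i l² / 8 with the cubic;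
        -- the next summand is i(l² - k²) / 8 with k = l - 1.
        (*-nonneg {+ 1 / 216} (ℚ.nonNegative⁻¹ (+ 1 / 216)) (*-nonneg (square-nonneg (l - 2ℚ * i)) (+-nonneg (*-nonneg (fromℕ-nonneg 4) 0≤l) 0≤i)))
        (*-nonneg (*-nonneg {+ 1 / 8} (ℚ.nonNegative⁻¹ (+ 1 / 8)) 0≤i) (+-nonneg (*-nonneg (fromℕ-nonneg 2) 0≤k) (fromℕ-nonneg 1))))
      (solve 2 (λ c i → let l = c :+ i :+ c ; k = l :- con 1ℚ in
          con (+ 1 / 8) :* i :* (k :* k)
          :+ (con (+ 1 / 216) :* ((l :- con 2ℚ :* i) :* (l :- con 2ℚ :* i) :* (con (fromℕ 4) :* l :+ i))
              :+ con (+ 1 / 8) :* i :* (con 2ℚ :* k :+ con 1ℚ))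
          := con (+ 4 / 27) :* ((c :+ i) :* (c :+ i) :* (c :+ i))) refl c i)
    where
    l = c + i + c
    0≤l : 0ℚ ≤ l
    0≤l = +-nonneg (+-nonneg 0≤c 0≤i) 0≤c
    0≤k : 0ℚ ≤ k
    -- This is 1 ≤ n ≤ n + c.
    0≤k = 0≤q-p (≤-trans 1≤n (≤-by-difference 0≤c refl))

-- From `c` and `i` back to `α` and `n`

theorem2 : (n : ℕ) → .{{_ : NonZero n}} → (α : ℚ) → 0ℚ ≤ α → α ≤ 1ℚ →
    (G : Graph n) (C : Subset n) (m : ℕ) → IsSplit G C →
    fromℕ ∣ C ∣ ≡ α * fromℕ n → fromℕ ∣ ∁ C ∣ ≡ (1ℚ - α) * fromℕ n →
    length (crossEdges G C) ≡ m →
    (fromℕ (Mo G) ≤ edgeBound n α m)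
    × (α ≤ threshold n →
    edgeBound n α m ≤ α * (1ℚ - α) * (fromℕ n * fromℕ n) * ((1ℚ - α) * fromℕ n - 1ℚ))
    × (threshold n < α →
    edgeBound n α m ≤ (+ 1 / 8) * ((1ℚ - α) * fromℕ n) * (((1ℚ + α) * fromℕ n - 1ℚ) * ((1ℚ + α) * fromℕ n - 1ℚ)))
    × (fromℕ (Mo G) ≤ (+ 4 / 27) * (fromℕ n * fromℕ n * fromℕ n))
theorem2 n α _ _ G C m split c≡αn i≡[1-α]n refl =
    Mo≤edgeBound
  , (λ α≤ → subst₂ _≤_ (sym edgeBound≡quadratic) endpoint≡ (quadratic-≤-endpoint 0≤m m≤ic (3c≤n-1 α≤)))
  , (λ _ → edgeBound≤vertex)
  -- The vertex value is an upper bound at every `t`, so this chain covers both ranges of `α`.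
  , (begin
      fromℕ (Mo G)                             ≤⟨ Mo≤quadratic ⟩
      quadratic k i (fromℕ m)                  ≤⟨ quadratic-≤-vertex 0≤m m≤ic ⟩
      (+ 1 / 8) * i * (k * k)                  ≤⟨ vertex-≤-cubic (subst (1ℚ ≤_) (sym c+i≡n) (fromℕ-mono-≤ {1} {n} (ℕ.>-nonZero⁻¹ n))) ⟩
      (+ 4 / 27) * ((c + i) * (c + i) * (c + i)) ≡⟨ cong (λ x → (+ 4 / 27) * (x * x * x)) c+i≡n ⟩
      (+ 4 / 27) * (fromℕ n * fromℕ n * fromℕ n) ∎)
  where
  open ℚ.≤-Reasoning
  open Counting.Split G C split
  c i : ℚ
  c = fromℕ ∣ C ∣
  i = fromℕ ∣ ∁ C ∣
  open Bounds {c} {i} (fromℕ-nonneg ∣ C ∣) (fromℕ-nonneg ∣ ∁ C ∣)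

  c+i≡n : c + i ≡ fromℕ n
  c+i≡n = trans (cong₂ _+_ c≡αn i≡[1-α]n)
    (solve 2 (λ α N → α :* N :+ (con 1ℚ :- α) :* N := N) refl α (fromℕ n))

  k≡ : k ≡ (1ℚ + α) * fromℕ n - 1ℚ
  k≡ = trans (cong₂ (λ x y → x + y - 1ℚ) c+i≡n c≡αn)
    (solve 2 (λ α N → N :+ α :* N :- con 1ℚ := (con 1ℚ :+ α) :* N :- con 1ℚ) refl α (fromℕ n))

  edgeBound≡quadratic : edgeBound n α m ≡ quadratic k i (fromℕ m)
  edgeBound≡quadratic = sym (cong₂ (λ x y → quadratic x y (fromℕ m)) k≡ i≡[1-α]n)

  0≤m : 0ℚ ≤ fromℕ m
  0≤m = fromℕ-nonneg m

  m≤ic : fromℕ m ≤ i * c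
  m≤ic = subst (fromℕ m ≤_) (fromℕ-* ∣ ∁ C ∣ ∣ C ∣) (fromℕ-mono-≤ crossEdges-≤)

  Mo≤quadratic : fromℕ (Mo G) ≤ quadratic k i (fromℕ m)
  -- The two remaining arguments are `Mo-bound` and `crossEdges²-≤`, carried over to ℚ.
  Mo≤quadratic = ≤-quadratic (fromℕ-nonneg sumOfSquares)
    (begin
      fromℕ (Mo G) + 2ℚ * fromℕ sumOfSquares + fromℕ m
        ≡⟨ cong (λ x → fromℕ (Mo G) + x + fromℕ m) (fromℕ-* 2 sumOfSquares) ⟨
      fromℕ (Mo G) + fromℕ (2 ℕ.* sumOfSquares) + fromℕ m
        ≡⟨ cong (_+ fromℕ m) (fromℕ-+ (Mo G) (2 ℕ.* sumOfSquares)) ⟨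
      fromℕ (Mo G ℕ.+ 2 ℕ.* sumOfSquares) + fromℕ m
        ≡⟨ fromℕ-+ (Mo G ℕ.+ 2 ℕ.* sumOfSquares) m ⟨
      fromℕ (Mo G ℕ.+ 2 ℕ.* sumOfSquares ℕ.+ m)
        ≤⟨ fromℕ-mono-≤ Mo-bound ⟩
      fromℕ ((n ℕ.+ ∣ C ∣) ℕ.* m)
        ≡⟨ fromℕ-* (n ℕ.+ ∣ C ∣) m ⟩
      fromℕ (n ℕ.+ ∣ C ∣) * fromℕ m
        ≡⟨ cong (_* fromℕ m) (fromℕ-+ n ∣ C ∣) ⟩
      (fromℕ n + c) * fromℕ m
        ≡⟨ cong (λ x → (x + c) * fromℕ m) c+i≡n ⟨
      (c + i + c) * fromℕ m ∎)
    (subst₂ _≤_ (fromℕ-* m m) (fromℕ-* ∣ ∁ C ∣ sumOfSquares) (fromℕ-mono-≤ crossEdges²-≤))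

  Mo≤edgeBound : fromℕ (Mo G) ≤ edgeBound n α m
  Mo≤edgeBound = subst (fromℕ (Mo G) ≤_) (sym edgeBound≡quadratic) Mo≤quadratic

  3c≤n-1 : α ≤ threshold n → c * fromℕ 3 ≤ c + i - 1ℚ
  3c≤n-1 α≤ = begin
    c * fromℕ 3                         ≡⟨ cong (_* fromℕ 3) c≡αn ⟩
    α * fromℕ n * fromℕ 3               ≡⟨ solve 2 (λ α N → α :* N :* con (fromℕ 3) := α :* (con (fromℕ 3) :* N)) refl α (fromℕ n) ⟩
    α * (fromℕ 3 * fromℕ n)             ≤⟨ ℚ.*-monoʳ-≤-nonNeg (fromℕ 3 * fromℕ n) {{nonNegative (*-nonneg (fromℕ-nonneg 3) (fromℕ-nonneg n))}} α≤ ⟩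
    threshold n * (fromℕ 3 * fromℕ n)   ≡⟨ threshold-scaled n ⟩
    fromℕ n - 1ℚ                        ≡⟨ cong (_- 1ℚ) c+i≡n ⟨
    c + i - 1ℚ                          ∎

  endpoint≡ : c * i * (i - 1ℚ) ≡ α * (1ℚ - α) * (fromℕ n * fromℕ n) * ((1ℚ - α) * fromℕ n - 1ℚ)
  endpoint≡ = trans (cong₂ (λ x y → x * y * (y - 1ℚ)) c≡αn i≡[1-α]n)
    (solve 2 (λ α N → α :* N :* ((con 1ℚ :- α) :* N) :* ((con 1ℚ :- α) :* N :- con 1ℚ)
        := α :* (con 1ℚ :- α) :* (N :* N) :* ((con 1ℚ :- α) :* N :- con 1ℚ)) refl α (fromℕ n))

  edgeBound≤vertex : edgeBound n α m ≤ (+ 1 / 8) * ((1ℚ - α) * fromℕ n) * (((1ℚ + α) * fromℕ n - 1ℚ) * ((1ℚ + α) * fromℕ n - 1ℚ))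
  edgeBound≤vertex = subst₂ _≤_ (sym edgeBound≡quadratic) (cong₂ (λ x y → (+ 1 / 8) * x * (y * y)) i≡[1-α]n k≡)
    (quadratic-≤-vertex 0≤m m≤ic)
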